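{- p-Commutativity fails in general: there exist a language $L$, an $L$-algebra $\mathfrak A$ with universe $A$, and elements $a,b\in A$ such that $a:b\not\approx_{\mathfrak A}b:a$.
   Context: Let $L$ be a language of algebras: a set of function symbols, each with an arity in $\mathbb N$ (constants are 0-ary function symbols). Fix a countably infinite set $X$ of variables; $T_{L,X}$ is the set of $L$-terms over $X$, and $X(s)$ denotes the set of variables occurring in a term $s$. For an $L$-algebra $\mathfrak A$ with universe $A$, every term $s$ induces a function $s^{\mathfrak A}$, evaluated at assignments of elements of $A$ to variables. An arrow of $\mathfrak A$ is a pair $(a,b)\in A\times A$, written $a\to b$. The generalizations of an arrow $a\to b$ in $\mathfrak A$ are the pairs of arbitrary terms $s\to t$ with $s,t\in T_{L,X}$ such that there is an assignment $\sigma$ of elements of $A$ to the variables in $X(s)\cup X(t)$ with $s^{\mathfrak A}(\sigma)=a$ and $t^{\mathfrak A}(\sigma)=b$; their set is denoted $\uparrow_{\mathfrak A}(a\to b)$. For $L$-algebras $\mathfrak A,\mathfrak B$, an arrow $a\to b$ of $\mathfrak A$ and an arrow $c\to d$ of $\mathfrak B$, set $(a\to b)\uparrow_{(\mathfrak A,\mathfrak B)}(c\to d):=\uparrow_{\mathfrak A}(a\to b)\cap\uparrow_{\mathfrak B}(c\to d)$. A pair of terms $s\to t$ is trivial in $(\mathfrak A,\mathfrak B)$ if it belongs to $\uparrow_{\mathfrak A}(e)$ for every arrow $e$ of $\mathfrak A$ and to $\uparrow_{\mathfrak B}(e')$ for every arrow $e'$ of $\mathfrak B$. We write $a\to b\lesssim_{(\mathfrak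 A,\mathfrak B)}c\to d$ iff either (i) every element of $\uparrow_{\mathfrak A}(a\to b)\cup\uparrow_{\mathfrak B}(c\to d)$ is trivial in $(\mathfrak A,\mathfrak B)$, or (ii) $(a\to b)\uparrow_{(\mathfrak A,\mathfrak B)}(c\to d)$ contains an element not trivial in $(\mathfrak A,\mathfrak B)$ and, for every arrow $c'\to d'$ of $\mathfrak B$, the inclusion $(a\to b)\uparrow_{(\mathfrak A,\mathfrak B)}(c\to d)\subseteq(a\to b)\uparrow_{(\mathfrak A,\mathfrak B)}(c'\to d')$ implies equality of these two sets. Define $a\to b\approx_{(\mathfrak A,\mathfrak B)}c\to d$ iff $a\to b\lesssim_{(\mathfrak A,\mathfrak B)}c\to d$ and $c\to d\lesssim_{(\mathfrak B,\mathfrak A)}a\to b$. For $a,b\in A$ and $c,d\in B$, the similarity-based analogical proportion $a:b\approx_{(\mathfrak A,\mathfrak B)}c:d$ holds iff $a\to b\approx_{(\mathfrak A,\mathfrak B)}c\to d$ and $b\to a\approx_{(\mathfrak A,\mathfrak B)}d\to c$. We write $\approx_{\mathfrak A}$ for $\approx_{(\mathfrak A,\mathfrak A)}$. -}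

module Defs where

open import Data.Nat using (ℕ)
open import Data.Product using (_×_; _,_; ∃-syntax; Σ-syntax)
open import Data.Sum using (_⊎_; inj₁; inj₂)
open import Data.Vec using (Vec; []; _∷_)
open import Data.Vec.Relation.Unary.Any using (Any; here; there)
open import Relation.Binary.PropositionalEquality using (_≡_)
open import Relation.Nullary using (¬_)
open import Relation.Unary using (Pred; _∈_; _∪_; _∩_; _⊆_; _≐_)
open import Level using (0ℓ)

record Language : Set₁ where
  field
    Symbol : Set
    arity  : Symbol → ℕ

open Language public

record Algebra (L : Language) : Set₁ where
  field
    Carrier : Set
    ⟦_⟧     : (f : Symbol L) → Vec Carrier (arity L f) → Carrier

open Algebra public using (Carrier)

X : Set
X = ℕ

data Term (L : Language) : Set where
  var : X → Term L
  op  : (f : Symbol L) → Vec (Term L) (arity L f) → Term L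

-- The membership proof is irrelevant, so the assigned value depends on the
-- variable only and not on how it is shown to lie in V.
Assignment : Pred X 0ℓ → Set → Set
Assignment V A = (x : X) → .(x ∈ V) → A

module _ {L : Language} where

  data Vars : Term L → Pred X 0ℓ where
    var : ∀ {x} → x ∈ Vars (var x)
    op  : ∀ {x f ts} → Any (λ t → x ∈ Vars t) ts → x ∈ Vars (op f ts)

  module _ (𝔄 : Algebra L) where
    open Algebra 𝔄 using (⟦_⟧)

    eval  : (s : Term L) → Assignment (Vars s) (Carrier 𝔄) → Carrier 𝔄
    evals : ∀ {n} (ts : Vec (Term L) n) →
            Assignment (λ x → Any (λ t → x ∈ Vars t) ts) (Carrier 𝔄) →
            Vec (Carrier 𝔄) n
    eval (var x)   σ = σ x var
    eval (op f ts) σ = ⟦ f ⟧ (evals ts (λ x p → σ x (op p)))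
    evals []       σ = []
    evals (t ∷ ts) σ = eval t (λ x p → σ x (here p)) ∷ evals ts (λ x p → σ x (there p))

Arrow : ∀ {L} → Algebra L → Set
Arrow 𝔄 = Carrier 𝔄 × Carrier 𝔄

infix 6 _⟶_
pattern _⟶_ a b = a , b

TermPair : Language → Set
TermPair L = Term L × Term L

↑ : ∀ {L} (𝔄 : Algebra L) → Arrow 𝔄 → Pred (TermPair L) 0ℓ
↑ 𝔄 (a ⟶ b) (s ⟶ t) =
  Σ[ σ ∈ Assignment (Vars s ∪ Vars t) (Carrier 𝔄) ]
    eval 𝔄 s (λ x p → σ x (inj₁ p)) ≡ a ×
    eval 𝔄 t (λ x p → σ x (inj₂ p)) ≡ b

module _ {L : Language} (𝔄 𝔅 : Algebra L) where

  ↑₂ : Arrow 𝔄 → Arrow 𝔅 → Pred (TermPair L) 0ℓ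
  ↑₂ e e′ = ↑ 𝔄 e ∩ ↑ 𝔅 e′

  Trivial : Pred (TermPair L) 0ℓ
  Trivial p = (∀ e → p ∈ ↑ 𝔄 e) × (∀ e′ → p ∈ ↑ 𝔅 e′)

  _≲_ : Arrow 𝔄 → Arrow 𝔅 → Set
  e ≲ e′ =
    (↑ 𝔄 e ∪ ↑ 𝔅 e′) ⊆ Trivial
    ⊎
    (∃[ p ] p ∈ ↑₂ e e′ × ¬ p ∈ Trivial) ×
    (∀ e″ → ↑₂ e e′ ⊆ ↑₂ e e″ → ↑₂ e e′ ≐ ↑₂ e e″)

module _ {L : Language} (𝔄 𝔅 : Algebra L) where

  ArrowSimilar : Arrow 𝔄 → Arrow 𝔅 → Set
  ArrowSimilar e e′ = _≲_ 𝔄 𝔅 e e′ × _≲_ 𝔅 𝔄 e′ e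

  Proportion : (a b : Carrier 𝔄) (c d : Carrier 𝔅) → Set
  Proportion a b c d =
    ArrowSimilar (a ⟶ b) (c ⟶ d) × ArrowSimilar (b ⟶ a) (d ⟶ c)

_⊨_∶_≈_∶_ : ∀ {L} (𝔄 : Algebra L) (a b c d : Carrier 𝔄) → Set
𝔄 ⊨ a ∶ b ≈ c ∶ d = Proportion 𝔄 𝔄 a b c d

{-# OPTIONS --safe #-}
-- Suppose ↑ e is contained in ↑ e″ for some arrow e″ of the target algebra.
-- Then e″ competes with e′ in the maximality clause of e ≲ e′, and its
-- intersection with ↑ e is all of ↑ e; hence e ≲ e′ forces ↑ e ⊆ ↑ e′.  Within
-- one algebra e″ = e always qualifies.  If a term s takes the value a at every
-- assignment, s → x generalizes a → b for every b, but no arrow with another source.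
module Submission where

open import Data.Bool using (Bool; true; false)
open import Data.Product using (Σ-syntax; _,_; proj₁; proj₂)
open import Data.Sum using (inj₁; inj₂)
open import Data.Unit using (⊤; tt)
open import Data.Vec using ([])
open import Function using (id)
open import Relation.Binary.PropositionalEquality using (_≡_; refl; sym; trans)
open import Relation.Nullary using (¬_; contradiction)
open import Relation.Unary using (_∈_; _⊆_)
open import Defs

↑⊆↑∧≲⇒↑⊆↑ : ∀ {L} (𝔄 𝔅 : Algebra L) {e : Arrow 𝔄} {e′ e″ : Arrow 𝔅} →
            ↑ 𝔄 e ⊆ ↑ 𝔅 e″ → _≲_ 𝔄 𝔅 e e′ → ↑ 𝔄 e ⊆ ↑ 𝔅 e′
↑⊆↑∧≲⇒↑⊆↑ 𝔄 𝔅 {e′ = e′} _ (inj₁ allTrivial) p∈↑e =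
  proj₂ (allTrivial (inj₁ p∈↑e)) e′
↑⊆↑∧≲⇒↑⊆↑ 𝔄 𝔅 {e} {e′} {e″} ↑e⊆↑e″ (inj₂ (_ , maximal)) p∈↑e =
  proj₂ (↑₂ee″⊆↑₂ee′ (p∈↑e , ↑e⊆↑e″ p∈↑e))
  where
  ↑₂ee″⊆↑₂ee′ : ↑₂ 𝔄 𝔅 e e″ ⊆ ↑₂ 𝔄 𝔅 e e′
  ↑₂ee″⊆↑₂ee′ = proj₂ (maximal e″ λ (q∈↑e , _) → q∈↑e , ↑e⊆↑e″ q∈↑e)

module _ {L : Language} (𝔄 : Algebra L) where

  ≲⇒↑⊆↑ : {e e′ : Arrow 𝔄} → _≲_ 𝔄 𝔄 e e′ → ↑ 𝔄 e ⊆ ↑ 𝔄 e′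
  ≲⇒↑⊆↑ = ↑⊆↑∧≲⇒↑⊆↑ 𝔄 𝔄 id

  HasConstantValue : Term L → Carrier 𝔄 → Set
  HasConstantValue s a = (σ : Assignment (Vars s) (Carrier 𝔄)) → eval 𝔄 s σ ≡ a

  module _ {s : Term L} {a : Carrier 𝔄} (s≡a : HasConstantValue s a) where

    constant⟶var∈↑ : ∀ x b → (s ⟶ var x) ∈ ↑ 𝔄 (a ⟶ b)
    constant⟶var∈↑ x b = (λ _ _ → b) , s≡a _ , refl

    constant⟶∈↑⇒source≡ : ∀ {t c d} → (s ⟶ t) ∈ ↑ 𝔄 (c ⟶ d) → a ≡ c
    constant⟶∈↑⇒source≡ (_ , s≡c , _) = trans (sym (s≡a _)) s≡c

    constant-≲⇒source≡ : ∀ {b c d} → _≲_ 𝔄 𝔄 (a ⟶ b) (c ⟶ d) → a ≡ c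
    constant-≲⇒source≡ {b} ab≲cd =
      constant⟶∈↑⇒source≡ (≲⇒↑⊆↑ ab≲cd (constant⟶var∈↑ 0 b))

    constant-∶≈∶⇒≡ : ∀ {b c d} → 𝔄 ⊨ a ∶ b ≈ c ∶ d → a ≡ c
    constant-∶≈∶⇒≡ ((ab≲cd , _) , _) = constant-≲⇒source≡ ab≲cd

oneConstant : Language
oneConstant = record { Symbol = ⊤ ; arity = λ _ → 0 }

pointedBool : Algebra oneConstant
pointedBool = record { Carrier = Bool ; ⟦_⟧ = λ _ _ → true }

constant-true : HasConstantValue pointedBool (op tt []) true
constant-true _ = refl

theorem3 : Σ[ L ∈ Language ] Σ[ 𝔄 ∈ Algebra L ] Σ[ a ∈ Carrier 𝔄 ] Σ[ b ∈ Carrier 𝔄 ]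
               ¬ (𝔄 ⊨ a ∶ b ≈ b ∶ a)
theorem3 = oneConstant , pointedBool , true , false ,
  λ tf≈ft → contradiction (constant-∶≈∶⇒≡ pointedBool constant-true tf≈ft) λ ()
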